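{- For every simple signed graph $G$ with underlying unsigned graph $\underline{G}$ we have $\chi(G)\le\chi_a(\underline{G})$, where $\chi_a(\underline{G})$ denotes the acyclic chromatic number of $\underline{G}$.
   Context: All graphs are finite and nonempty. A signed graph $G$ is a graph in which each edge $e$ is labelled with a sign $\sigma(e)\in\{+1,-1\}$; its underlying unsigned graph, obtained by forgetting the signs, is denoted by $\underline{G}$, and $G$ is simple if $\underline{G}$ has no loops and no parallel edges. A proper colouring of $G$ is a mapping $\phi\colon V(G)\to\mathbb{Z}$ such that for each edge $e=uv$ of $G$ we have $\phi(u)\neq\sigma(e)\phi(v)$. For $n\ge1$ let $M_n=\{\pm1,\pm2,\ldots,\pm k\}$ if $n=2k$, and $M_n=\{0,\pm1,\pm2,\ldots,\pm k\}$ if $n=2k+1$. An $n$-colouring of $G$ is a proper colouring of $G$ using colours from $M_n$. The chromatic number $\chi(G)$ of a signed graph $G$ is the smallest $n\ge 1$ such that $G$ admits an $n$-colouring. An acyclic colouring of an unsigned graph $H$ is a proper vertex colouring of $H$ in the usual sense (each colour class is an independent set) such that the union of any two colour classes induces a forest; the acyclic chromatic number $\chi_a(H)$ is the minimum number of colours in an acyclic colouring of $H$. -}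

module Defs where

open import Data.Empty using (⊥)
open import Data.Fin.Base using (Fin; zero; suc; toℕ; fromℕ<; splitAt; join; finToFun; funToFin)
import Data.Fin.Properties as Fin
open import Data.Integer.Base as ℤ using (ℤ; +_; +[1+_]; ∣_∣; _◃_)
import Data.Integer.Properties as ℤ
open import Data.List.Base using (List; []; _∷_; length; lookup)
open import Data.List.Relation.Unary.All as All using (All; []; _∷_)
open import Data.List.Membership.Propositional.Properties using (∈-lookup)
import Data.List.Relation.Unary.AllPairs as AllPairs
open AllPairs using ([]; _∷_)
open import Data.List.Relation.Unary.Unique.Propositional using (Unique)
open import Data.Nat.Base
  using (ℕ; zero; suc; _+_; _*_; _^_; _≤_; z≤n; s≤s; NonZero; >-nonZero⁻¹)
import Data.Nat.Properties as ℕ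
open import Data.Product.Base using (∃; _×_; _,_; proj₁; proj₂)
open import Data.Product.Properties using (≡-dec)
open import Data.Sign.Base as Sign using (Sign)
open import Data.Sum.Base using (_⊎_; inj₁; inj₂; [_,_]′; swap)
open import Function.Base using (_∘_; id)
open import Level using (0ℓ)
open import Relation.Binary.PropositionalEquality
  using (_≡_; _≢_; _≗_; refl; sym; trans; cong; subst; subst₂)
open import Relation.Nullary using (¬_; Dec; yes; no; contradiction)
open import Relation.Nullary.Decidable
  using (map′; ¬?; _×-dec_; _⊎-dec_; _→-dec_)
open import Relation.Unary using (Pred; Decidable; _∈_; _∪_)

------------------------------------------------------------------------
-- Graphs (loops and parallel edges allowed)

-- `ends e` lists the two ends of `e` in an arbitrary order; everything
-- below refers to it only through the symmetric relation `Joins`.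

record Graph : Set where
  field
    order        : ℕ
    .{{nonempty}} : NonZero order
    size         : ℕ

  Vertex : Set
  Vertex = Fin order

  Edge : Set
  Edge = Fin size

  field
    ends : Edge → Vertex × Vertex

  Joins : Edge → Vertex → Vertex → Set
  Joins e u v = ends e ≡ (u , v) ⊎ ends e ≡ (v , u)

  Loopless : Set
  Loopless = ∀ {e u} → ¬ Joins e u u

  NoParallelEdges : Set
  NoParallelEdges = ∀ {e f u v} → Joins e u v → Joins f u v → e ≡ f

  IsSimple : Set
  IsSimple = Loopless × NoParallelEdges

  data Walk : Vertex → Vertex → Set where
    nil  : ∀ {u} → Walk u u
    cons : ∀ {u v w} (e : Edge) → Joins e u v → Walk v w → Walk u w

  edges : ∀ {u v} → Walk u v → List Edge
  edges nil          = []
  edges (cons e _ p) = e ∷ edges p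

  -- The final vertex is omitted, so a closed walk lists its base point
  -- only once.
  vertices : ∀ {u v} → Walk u v → List Vertex
  vertices nil                = []
  vertices (cons {u = u} _ _ p) = u ∷ vertices p

  -- Distinctness of the edges is what excludes u, e, v, e, u; a loop and
  -- a pair of parallel edges are cycles of length 1 and 2.
  IsCycle : ∀ {u} → Walk u u → Set
  IsCycle p = 1 ≤ length (edges p) × Unique (vertices p) × Unique (edges p)

  -- The cycles of the subgraph induced by S are the cycles of the graph
  -- all of whose vertices lie in S.
  InducesForest : Pred Vertex 0ℓ → Set
  InducesForest S = ∀ {u} (p : Walk u u) → IsCycle p → ¬ All S (vertices p)

  IsProperColouring : ∀ {C : Set} → (Vertex → C) → Set
  IsProperColouring c = ∀ e u v → Joins e u v → c u ≢ c v

  ColourClass : ∀ {C : Set} → (Vertex → C) → C → Pred Vertex 0ℓ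
  ColourClass c a v = c v ≡ a

  IsAcyclicColouring : ∀ {C : Set} → (Vertex → C) → Set
  IsAcyclicColouring c = IsProperColouring c ×
    (∀ a b → a ≢ b → InducesForest (ColourClass c a ∪ ColourClass c b))

  AcyclicallyColourable : ℕ → Set
  AcyclicallyColourable k = ∃ λ (c : Vertex → Fin k) → IsAcyclicColouring c

------------------------------------------------------------------------
-- Signed graphs

-- M n is {±1, …, ±k} if n = 2k, and {0, ±1, …, ±k} if n = 2k + 1.
M : ℕ → Pred ℤ 0ℓ
M n z = ∃ λ k → (n ≡ 2 * k × 1 ≤ ∣ z ∣ × ∣ z ∣ ≤ k)
              ⊎ (n ≡ 2 * k + 1 × ∣ z ∣ ≤ k)

-- The product of a sign, read as an element of {+1, -1}, with an integer.
infixr 7 _·_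
_·_ : Sign → ℤ → ℤ
s · z = (s ◃ 1) ℤ.* z

record SignedGraph : Set where
  field
    underlying : Graph

  open Graph underlying public
    using (order; Vertex; Edge; Joins; IsSimple)

  field
    σ : Edge → Sign

  IsProperSignedColouring : (Vertex → ℤ) → Set
  IsProperSignedColouring φ = ∀ e u v → Joins e u v → φ u ≢ σ e · φ v

  IsColouring : ℕ → (Vertex → ℤ) → Set
  IsColouring n φ = IsProperSignedColouring φ × (∀ v → φ v ∈ M n)

  Colourable : ℕ → Set
  Colourable n = ∃ λ φ → IsColouring n φ

------------------------------------------------------------------------
-- Chromatic numbers, as specifications

IsLeast : Pred ℕ 0ℓ → ℕ → Set
IsLeast P n = P n × (∀ m → P m → n ≤ m)

IsChromaticNumber : SignedGraph → ℕ → Set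
IsChromaticNumber G = IsLeast (λ n → 1 ≤ n × SignedGraph.Colourable G n)

IsAcyclicChromaticNumber : Graph → ℕ → Set
IsAcyclicChromaticNumber H = IsLeast (Graph.AcyclicallyColourable H)

------------------------------------------------------------------------
-- Both numbers exist for simple graphs: colourability is decidable by
-- exhaustive search, and giving all vertices different (positive)
-- colours always works.

least : ∀ {P : Pred ℕ 0ℓ} → Decidable P → ∀ n → P n → ∃ (IsLeast P)
least P? n pn with P? 0
... | yes p0 = 0 , p0 , λ _ _ → z≤n
least P? zero    pn | no ¬p0 = contradiction pn ¬p0
least {P} P? (suc n) pn | no ¬p0 with least (P? ∘ suc) n pn
... | m , pm , min = suc m , pm , minimal
  where
  minimal : ∀ k → P k → suc m ≤ k
  minimal zero    p = contradiction p ¬p0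
  minimal (suc k) p = s≤s (min k p)

anyFunction? : ∀ {m k} {P : (Fin m → Fin k) → Set} →
               (∀ {f g} → f ≗ g → P f → P g) →
               (∀ f → Dec (P f)) → Dec (∃ P)
anyFunction? {m} {k} {P} resp P? =
  map′ (λ (i , p) → finToFun i , p)
       (λ (f , p) → funToFin f , resp (sym ∘ Fin.finToFun-funToFin f) p)
       (Fin.any? {n = k ^ m} (λ i → P? (finToFun i)))

any≡? : ∀ {A : Set} {x y : A} {P : x ≡ y → Set} →
        Dec (x ≡ y) → (∀ q → Dec (P q)) → Dec (∃ P)
any≡? (no x≢y)   P? = no λ (q , _) → x≢y q
any≡? (yes refl) P? = map′ (refl ,_) (λ { (refl , p) → p }) (P? refl)

any⊎? : ∀ {A B : Set} {P : A ⊎ B → Set} →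
        Dec (∃ (P ∘ inj₁)) → Dec (∃ (P ∘ inj₂)) → Dec (∃ P)
any⊎? a? b? =
  map′ (λ { (inj₁ (a , p)) → inj₁ a , p ; (inj₂ (b , p)) → inj₂ b , p })
       (λ { (inj₁ a , p) → inj₁ (a , p) ; (inj₂ b , p) → inj₂ (b , p) })
       (a? ⊎-dec b?)

lookup-injective : ∀ {A : Set} {xs : List A} → Unique xs →
                   ∀ {i j} → lookup xs i ≡ lookup xs j → i ≡ j
lookup-injective (_ ∷ _)  {zero}  {zero}  _  = refl
lookup-injective (x ∷ _)  {zero}  {suc j} eq = contradiction eq (All.lookup x (∈-lookup j))
lookup-injective (x ∷ _)  {suc i} {zero}  eq = contradiction (sym eq) (All.lookup x (∈-lookup i))
lookup-injective (_ ∷ xs) {suc i} {suc j} eq = cong suc (lookup-injective xs eq)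

unique⇒length≤ : ∀ {n} {xs : List (Fin n)} → Unique xs → length xs ≤ n
unique⇒length≤ u = Fin.injective⇒≤ (lookup-injective u)

module _ (H : Graph) where
  open Graph H

  ends≟ : ∀ e uv → Dec (ends e ≡ uv)
  ends≟ e uv = ≡-dec Fin._≟_ Fin._≟_ (ends e) uv

  joins? : ∀ e u v → Dec (Joins e u v)
  joins? e u v = ends≟ e (u , v) ⊎-dec ends≟ e (v , u)

  length-edges : ∀ {u v} (p : Walk u v) → length (edges p) ≡ length (vertices p)
  length-edges nil          = refl
  length-edges (cons _ _ p) = cong suc (length-edges p)

  anyWalk? : ∀ b {u v} {P : Walk u v → Set} → (∀ p → Dec (P p)) →
             Dec (∃ λ p → length (edges p) ≤ b × P p)
  anyWalk? b {u} {v} {P} P? =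
    map′ (λ { (inj₁ (refl , q)) → nil , z≤n , q ; (inj₂ q) → fromCons b q })
         (λ { (nil , _ , q)           → inj₁ (refl , q)
            ; (cons e j p , l , q) → inj₂ (toCons b e j p l q) })
         (nil? ⊎-dec cons? b)
    where
    NilCase : u ≡ v → Set
    NilCase refl = P nil

    nilCase? : ∀ q → Dec (NilCase q)
    nilCase? refl = P? nil

    nil? : Dec (∃ NilCase)
    nil? = any≡? (u Fin.≟ v) nilCase?

    ConsCase : ℕ → Set
    ConsCase zero    = ⊥
    ConsCase (suc b) = ∃ λ e → ∃ λ w → ∃ λ (j : Joins e u w) →
      ∃ λ p → length (edges p) ≤ b × P (cons e j p)

    cons? : ∀ b → Dec (ConsCase b)
    cons? zero    = no λ ()
    cons? (suc b) = Fin.any? λ e → Fin.any? λ w →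
      any⊎? (any≡? (ends≟ e (u , w)) λ q → anyWalk? b (λ p → P? (cons e (inj₁ q) p)))
            (any≡? (ends≟ e (w , u)) λ q → anyWalk? b (λ p → P? (cons e (inj₂ q) p)))

    fromCons : ∀ b → ConsCase b → ∃ λ p → length (edges p) ≤ b × P p
    fromCons (suc b) (e , w , j , p , l , q) = cons e j p , s≤s l , q

    toCons : ∀ b {w} e (j : Joins e u w) p → suc (length (edges p)) ≤ b →
             P (cons e j p) → ConsCase b
    toCons (suc b) e j p (s≤s l) q = e , _ , j , p , l , q

  isCycle? : ∀ {u} (p : Walk u u) → Dec (IsCycle p)
  isCycle? p = (1 ℕ.≤? length (edges p))
         ×-dec AllPairs.allPairs? (λ x y → ¬? (x Fin.≟ y)) (vertices p)
         ×-dec AllPairs.allPairs? (λ x y → ¬? (x Fin.≟ y)) (edges p)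

  inducesForest? : ∀ {S} → Decidable S → Dec (InducesForest S)
  inducesForest? {S} S? =
    map′ (λ none p c s → none (_ , p , short p c , c , s))
         (λ { f (_ , p , _ , c , s) → f p c s })
         (¬? (Fin.any? λ u → anyWalk? order λ p →
                isCycle? {u} p ×-dec All.all? S? (vertices p)))
    where
    short : ∀ {u} (p : Walk u u) → IsCycle p → length (edges p) ≤ order
    short p (_ , uv , _) =
      subst (_≤ order) (sym (length-edges p)) (unique⇒length≤ uv)

  isAcyclicColouring? : ∀ {k} (c : Vertex → Fin k) → Dec (IsAcyclicColouring c)
  isAcyclicColouring? c =
    (Fin.all? λ e → Fin.all? λ u → Fin.all? λ v →
       joins? e u v →-dec ¬? (c u Fin.≟ c v))
    ×-dec
    (Fin.all? λ a → Fin.all? λ b → ¬? (a Fin.≟ b) →-dec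
       inducesForest? (λ v → (c v Fin.≟ a) ⊎-dec (c v Fin.≟ b)))

  isAcyclicColouring-resp : ∀ {k} {c d : Vertex → Fin k} → c ≗ d →
                            IsAcyclicColouring c → IsAcyclicColouring d
  isAcyclicColouring-resp c≗d (proper , forest) =
    (λ e u v j → subst₂ _≢_ (c≗d u) (c≗d v) (proper e u v j)) ,
    (λ a b a≢b p cyc s → forest a b a≢b p cyc (All.map
      (λ { {v} (inj₁ q) → inj₁ (trans (c≗d v) q)
         ; {v} (inj₂ q) → inj₂ (trans (c≗d v) q) }) s))

  acyclicallyColourable? : Decidable AcyclicallyColourable
  acyclicallyColourable? k =
    anyFunction? isAcyclicColouring-resp isAcyclicColouring?

  module _ (simple : IsSimple) where
    id-isAcyclicColouring : IsAcyclicColouring {C = Vertex} id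
    id-isAcyclicColouring =
      (λ { e u .u j refl → proj₁ simple j }) , (λ a b _ → forest a b)
      where
      forest : ∀ a b → InducesForest (ColourClass id a ∪ ColourClass id b)
      forest a b (cons e j nil) _ _ = proj₁ simple j
      forest a b (cons e j (cons f k nil)) (_ , _ , (e≢f ∷ []) ∷ _) _ =
        e≢f (proj₂ simple j (swap k))
      forest a b (cons e j (cons f k (cons g l p)))
        (_ , (x≢y ∷ x≢z ∷ _) ∷ (y≢z ∷ _) ∷ _ , _) (x ∷ y ∷ z ∷ _) =
        three x y z
        where
        three : _ ⊎ _ → _ ⊎ _ → _ ⊎ _ → _
        three (inj₁ p) (inj₁ q) _        = x≢y (trans p (sym q))
        three (inj₂ p) (inj₂ q) _        = x≢y (trans p (sym q))
        three (inj₁ p) (inj₂ _) (inj₁ q) = x≢z (trans p (sym q))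
        three (inj₂ p) (inj₁ _) (inj₂ q) = x≢z (trans p (sym q))
        three (inj₁ _) (inj₂ p) (inj₂ q) = y≢z (trans p (sym q))
        three (inj₂ _) (inj₁ p) (inj₁ q) = y≢z (trans p (sym q))

    acyclicChromaticNumber : ∃ (IsAcyclicChromaticNumber H)
    acyclicChromaticNumber =
      least acyclicallyColourable? order (id , id-isAcyclicColouring)

∈M? : ∀ n → Decidable (M n)
∈M? n z =
  map′ (λ (i , p) → toℕ i , p)
       (λ (k , p) → fromℕ< (s≤s (bound k p)) ,
          subst Body (sym (Fin.toℕ-fromℕ< (s≤s (bound k p)))) p)
       (Fin.any? {n = suc n} (λ i → body? (toℕ i)))
  where
  Body : ℕ → Set
  Body k = (n ≡ 2 * k × 1 ≤ ∣ z ∣ × ∣ z ∣ ≤ k) ⊎ (n ≡ 2 * k + 1 × ∣ z ∣ ≤ k)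

  body? : ∀ k → Dec (Body k)
  body? k = ((n ℕ.≟ 2 * k) ×-dec (1 ℕ.≤? ∣ z ∣) ×-dec (∣ z ∣ ℕ.≤? k))
      ⊎-dec ((n ℕ.≟ 2 * k + 1) ×-dec (∣ z ∣ ℕ.≤? k))

  bound : ∀ k → Body k → k ≤ n
  bound k (inj₁ (refl , _)) = ℕ.m≤m+n k _
  bound k (inj₂ (refl , _)) = ℕ.≤-trans (ℕ.m≤m+n k _) (ℕ.m≤m+n (2 * k) 1)

∈M⇒∣∣≤ : ∀ {n} z → z ∈ M n → ∣ z ∣ ≤ n
∈M⇒∣∣≤ z (k , inj₁ (refl , _ , l)) = ℕ.≤-trans l (ℕ.m≤m+n k _)
∈M⇒∣∣≤ z (k , inj₂ (refl , l))     =
  ℕ.≤-trans l (ℕ.≤-trans (ℕ.m≤m+n k _) (ℕ.m≤m+n (2 * k) 1))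

-- decode n enumerates the integers z with ∣ z ∣ ≤ n.
decode : ∀ n → Fin (suc n + suc n) → ℤ
decode n i = [ (λ j → + toℕ j) , (λ j → ℤ.- (+ toℕ j)) ]′ (splitAt (suc n) i)

encode : ∀ n z → ∣ z ∣ ≤ n → ∃ λ i → decode n i ≡ z
encode n (+ m) l = join (suc n) (suc n) (inj₁ (fromℕ< (s≤s l))) , eq
  where
  eq : decode n (join (suc n) (suc n) (inj₁ (fromℕ< (s≤s l)))) ≡ + m
  eq rewrite Fin.splitAt-join (suc n) (suc n) (inj₁ (fromℕ< (s≤s l)))
    = cong +_ (Fin.toℕ-fromℕ< (s≤s l))
encode n ℤ.-[1+ m ] l = join (suc n) (suc n) (inj₂ (fromℕ< (s≤s l))) , eq
  where
  eq : decode n (join (suc n) (suc n) (inj₂ (fromℕ< (s≤s l)))) ≡ ℤ.-[1+ m ]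
  eq rewrite Fin.splitAt-join (suc n) (suc n) (inj₂ (fromℕ< (s≤s l)))
    = cong (λ k → ℤ.- (+ k)) (Fin.toℕ-fromℕ< (s≤s l))

module _ (G : SignedGraph) where
  open SignedGraph G

  isColouring? : ∀ n φ → Dec (IsColouring n φ)
  isColouring? n φ =
    (Fin.all? λ e → Fin.all? λ u → Fin.all? λ v →
       joins? underlying e u v →-dec ¬? (φ u ℤ.≟ σ e · φ v))
    ×-dec Fin.all? (λ v → ∈M? n (φ v))

  isColouring-resp : ∀ {n φ ψ} → φ ≗ ψ → IsColouring n φ → IsColouring n ψ
  isColouring-resp {n} φ≗ψ (proper , colours) =
    (λ e u v j → subst₂ _≢_ (φ≗ψ u) (cong (σ e ·_) (φ≗ψ v)) (proper e u v j)) ,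
    (λ v → subst (M n) (φ≗ψ v) (colours v))

  colourable? : Decidable Colourable
  colourable? n =
    map′ (λ (f , p) → decode n ∘ f , p)
         (λ (φ , p) → let code v = encode n (φ v) (∈M⇒∣∣≤ (φ v) (proj₂ p v)) in
            proj₁ ∘ code , isColouring-resp (sym ∘ proj₂ ∘ code) p)
         (anyFunction?
            (λ f≗g → isColouring-resp (cong (decode n) ∘ f≗g))
            (λ f → isColouring? n (decode n ∘ f)))

  module _ (simple : IsSimple) where
    positive-isColouring : IsColouring (2 * order) (λ v → +[1+ toℕ v ])
    positive-isColouring =
      proper , λ v → order , inj₁ (refl , s≤s z≤n , Fin.toℕ<n v)
      where
      distinct : ∀ s u v → u ≢ v → +[1+ toℕ u ] ≢ s · +[1+ toℕ v ]
      distinct Sign.+ u v u≢v eq = u≢v (Fin.toℕ-injective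
        (ℤ.+[1+-injective (trans eq (ℤ.*-identityˡ _))))
      distinct Sign.- u v u≢v ()

      proper : IsProperSignedColouring (λ v → +[1+ toℕ v ])
      proper e u v j = distinct (σ e) u v λ { refl → proj₁ simple j }

    chromaticNumber : ∃ (IsChromaticNumber G)
    chromaticNumber =
      least (λ n → (1 ℕ.≤? n) ×-dec colourable? n) (2 * order)
        ( ℕ.≤-trans (>-nonZero⁻¹ order) (ℕ.m≤m+n order _)
        , _ , positive-isColouring)

------------------------------------------------------------------------
-- Chromatic numbers of simple graphs

χ : (G : SignedGraph) → SignedGraph.IsSimple G → ℕ
χ G simple = proj₁ (chromaticNumber G simple)

χ-isChromaticNumber : ∀ G simple → IsChromaticNumber G (χ G simple)
χ-isChromaticNumber G simple = proj₂ (chromaticNumber G simple)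

χₐ : (H : Graph) → Graph.IsSimple H → ℕ
χₐ H simple = proj₁ (acyclicChromaticNumber H simple)

χₐ-isAcyclicChromaticNumber :
  ∀ H simple → IsAcyclicChromaticNumber H (χₐ H simple)
χₐ-isAcyclicChromaticNumber H simple =
  proj₂ (acyclicChromaticNumber H simple)

{-# OPTIONS --safe #-}
-- The colours {1, …, n} of an acyclic colouring are grouped into pairs (and one
-- singleton if n is odd), and the i-th pair is replaced by the two signed
-- colours ±i, the singleton by 0.  Each pair of classes induces a forest, and
-- on a forest the signs can be chosen so that every edge e = uv satisfies
-- φ(u) = −σ(e)φ(v): add the edges one at a time, each joining two components,
-- and multiply one of these components by a suitable sign.
module Submission where

open import Defs
open import Data.Bool.Base using (if_then_else_)
open import Data.Fin.Base using (Fin; toℕ; fromℕ<)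
import Data.Fin.Properties as Fin
open import Data.Integer.Base using (ℤ; ∣_∣; _◃_)
import Data.Integer.Properties as ℤ
open import Data.List.Base using (List; []; _∷_; allFin; filter)
open import Data.List.Membership.Propositional using (_∈_; _∉_)
open import Data.List.Membership.Propositional.Properties
  using (∈-allFin; ∈-filter⁺; ∈-filter⁻)
import Data.List.Membership.DecPropositional as DecMembership
open import Data.List.Relation.Unary.All as All using (All; []; _∷_)
open import Data.List.Relation.Unary.All.Properties using (¬Any⇒All¬; All¬⇒¬Any)
open import Data.List.Relation.Unary.AllPairs using ([]; _∷_)
open import Data.List.Relation.Unary.Any using (here; there)
open import Data.List.Relation.Unary.Unique.Propositional using (Unique)
import Data.List.Relation.Unary.Unique.Propositional.Properties as Unique
open import Data.Nat.Base
  using (ℕ; zero; suc; _+_; _*_; _≤_; z≤n; s≤s; ⌊_/2⌋; >-nonZero⁻¹)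
import Data.Nat.Properties as ℕ
open import Data.Product.Base using (∃; _×_; _,_; proj₁; proj₂)
open import Data.Sign.Base as Sign using (Sign; opposite)
import Data.Sign.Properties as Sign
open import Data.Sum.Base using (_⊎_; inj₁; inj₂; swap)
import Data.Sum.Base as Sum
open import Function.Base using (_∘_)
open import Relation.Binary.Construct.Closure.ReflexiveTransitive as Star
  using (Star; ε; _◅_; _◅◅_)
open import Relation.Binary.PropositionalEquality
open import Relation.Nullary using (¬_; Dec; yes; no; does; contradiction)
open import Relation.Nullary.Decidable using (dec-true; dec-false)

-- Paths and cycles within a set of edges.

module Forests (H : Graph) where
  open Graph H
  open DecMembership (Fin._≟_ {order}) using (_∈?_)

  Adjacent : List Edge → Vertex → Vertex → Set
  Adjacent L u v = ∃ λ e → e ∈ L × Joins e u v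

  Connected : List Edge → Vertex → Vertex → Set
  Connected L = Star (Adjacent L)

  Acyclic : List Edge → Set
  Acyclic L = ∀ {u} (p : Walk u u) → IsCycle p → ¬ All (_∈ L) (edges p)

  -- `vertices` omits the end `v`, so it is added here. Placed in front, it yields the vertex list
  -- of the closed walk obtained by prepending an edge from `v` to `u`.
  IsPath : ∀ {u v} → Walk u v → Set
  IsPath {v = v} p = Unique (v ∷ vertices p)

  Path : List Edge → Vertex → Vertex → Set
  Path L u v = ∃ λ (p : Walk u v) → IsPath p × All (_∈ L) (edges p)

  suffix : ∀ {L u v w} (p : Walk v w) → u ∈ vertices p → IsPath p →
           All (_∈ L) (edges p) → Path L u w
  suffix (cons e j p) (here refl) path inL = cons e j p , path , inL
  suffix (cons e j p) (there u∈p) ((_ ∷ w∉p) ∷ _ ∷ unique) (_ ∷ inL) =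
    suffix p u∈p (w∉p ∷ unique) inL

  -- Loop erasure: when the new first vertex already lies on the path, the part before it is cut
  -- off. The end vertex is tested separately because `vertices` omits it.
  connected⇒path : ∀ {L u v} → Connected L u v → Path L u v
  connected⇒path ε = nil , [] ∷ [] , []
  connected⇒path {u = u} {w} ((e , e∈L , j) ◅ s)
    with connected⇒path s
  ... | p , path@(w∉p ∷ unique) , inL with u Fin.≟ w | u ∈? vertices p
  ...   | yes refl | _        = nil , [] ∷ [] , []
  ...   | no _     | yes u∈p  = suffix p u∈p path inL
  ...   | no u≢w   | no u∉p   =
    cons e j p , ((u≢w ∘ sym) ∷ w∉p) ∷ ¬Any⇒All¬ _ u∉p ∷ unique , e∈L ∷ inL

  joins-unique : ∀ {e u v x y} → Joins e u v → Joins e x y →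
                 (x ≡ u × y ≡ v) ⊎ (x ≡ v × y ≡ u)
  joins-unique (inj₁ p) (inj₁ q) with refl ← trans (sym p) q = inj₁ (refl , refl)
  joins-unique (inj₁ p) (inj₂ q) with refl ← trans (sym p) q = inj₂ (refl , refl)
  joins-unique (inj₂ p) (inj₁ q) with refl ← trans (sym p) q = inj₂ (refl , refl)
  joins-unique (inj₂ p) (inj₂ q) with refl ← trans (sym p) q = inj₁ (refl , refl)

  source∈ : ∀ {u v} (p : Walk u v) → u ∈ v ∷ vertices p
  source∈ nil          = here refl
  source∈ (cons _ _ p) = there (here refl)

  weaken-∈ : ∀ {x y w : Vertex} {xs} → x ∈ w ∷ xs → x ∈ w ∷ y ∷ xs
  weaken-∈ (here q)  = here q
  weaken-∈ (there q) = there (there q)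

  end∈vertices : ∀ {u v f x y} (p : Walk u v) → f ∈ edges p → Joins f x y →
                 x ∈ v ∷ vertices p
  end∈vertices (cons e j p) (here refl) k with joins-unique j k
  ... | inj₁ (refl , _) = there (here refl)
  ... | inj₂ (refl , _) = weaken-∈ (source∈ p)
  end∈vertices (cons e j p) (there f∈p) k = weaken-∈ (end∈vertices p f∈p k)

  -- If the first edge occurred again, the rest of the path would return to the starting vertex.
  path⇒uniqueEdges : ∀ {u v} (p : Walk u v) → IsPath p → Unique (edges p)
  path⇒uniqueEdges nil _ = []
  path⇒uniqueEdges (cons e j p) ((w≢u ∷ w∉p) ∷ u∉p ∷ unique) =
    ¬Any⇒All¬ _ (λ e∈p → All¬⇒¬Any ((w≢u ∘ sym) ∷ u∉p) (end∈vertices p e∈p j))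
    ∷ path⇒uniqueEdges p (w∉p ∷ unique)

  -- A path from `v` to `u` in `L` closes up with `e` to a cycle; its edges are distinct because
  -- `e ∉ L`. For a loop `e` the path is empty.
  acyclic⇒disconnected : ∀ {e L u v} → Acyclic (e ∷ L) → e ∉ L → Joins e u v →
                         ¬ Connected L v u
  acyclic⇒disconnected {e} acyclic e∉L j s with connected⇒path s
  ... | p , path , inL =
    acyclic (cons e j p)
      ( s≤s z≤n , path
      , All.map (λ { f∈L refl → e∉L f∈L }) inL ∷ path⇒uniqueEdges p path )
      (here refl ∷ All.map there inL)

  -- Balancing signs on a forest.

  record Balancing (τ : Edge → Sign) (L : List Edge) : Set where
    field
      sign      : Vertex → Sign
      component : Vertex → Vertex
      balanced  : ∀ {e u v} → e ∈ L → Joins e u v → sign u ≡ τ e Sign.* sign v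
      joined    : ∀ {e u v} → e ∈ L → Joins e u v → component u ≡ component v
      -- With `joined`, this makes the fibres of `component` exactly the components of the graph
      -- with edge set `L`. This direction turns acyclicity into distinct labels for the ends of a
      -- new edge.
      connected : ∀ {u v} → component u ≡ component v → Connected L u v

  module Extend {τ e L a b} (B : Balancing τ L) (acyclic : Acyclic (e ∷ L))
                (e∉L : e ∉ L) (j : Joins e a b) where
    open Balancing B

    a≁b : component b ≢ component a
    a≁b = acyclic⇒disconnected acyclic e∉L j ∘ connected

    merge : Vertex → Vertex
    merge i = if does (i Fin.≟ component a) then component b else i

    -- One factor per component label, so the edges of `L` stay balanced. For the component of `a`
    -- it is the solution `s` of `s * sign a ≡ τ e * sign b`, as signs square to `+`.
    scale : Vertex → Sign
    scale i =
      if does (i Fin.≟ component a) then τ e Sign.* sign b Sign.* sign a else Sign.+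

    sign′ : Vertex → Sign
    sign′ x = scale (component x) Sign.* sign x

    sign′-a : sign′ a ≡ τ e Sign.* sign b
    sign′-a rewrite dec-true (component a Fin.≟ component a) refl = begin
      (τ e Sign.* sign b Sign.* sign a) Sign.* sign a
        ≡⟨ Sign.*-assoc (τ e Sign.* sign b) (sign a) (sign a) ⟩
      (τ e Sign.* sign b) Sign.* (sign a Sign.* sign a)
        ≡⟨ cong (τ e Sign.* sign b Sign.*_) (Sign.s*s≡+ (sign a)) ⟩
      (τ e Sign.* sign b) Sign.* Sign.+
        ≡⟨ Sign.*-identityʳ _ ⟩
      τ e Sign.* sign b ∎
      where open ≡-Reasoning

    sign′-b : sign′ b ≡ sign b
    sign′-b rewrite dec-false (component b Fin.≟ component a) a≁b = refl

    merge-a : merge (component a) ≡ component b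
    merge-a rewrite dec-true (component a Fin.≟ component a) refl = refl

    merge-b : merge (component b) ≡ component b
    merge-b rewrite dec-false (component b Fin.≟ component a) a≁b = refl

    balanced′ : ∀ {f u v} → f ∈ e ∷ L → Joins f u v → sign′ u ≡ τ f Sign.* sign′ v
    balanced′ (here refl) k with joins-unique j k
    ... | inj₁ (refl , refl) = trans sign′-a (cong (τ e Sign.*_) (sym sign′-b))
    -- The new edge read backwards: `τ e` is its own inverse, so the equation is symmetric in the
    -- two ends.
    ... | inj₂ (refl , refl) = begin
      sign′ b                         ≡⟨ sign′-b ⟩
      sign b                          ≡⟨ cong (Sign._* sign b) (Sign.s*s≡+ (τ e)) ⟨
      (τ e Sign.* τ e) Sign.* sign b  ≡⟨ Sign.*-assoc (τ e) (τ e) (sign b) ⟩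
      τ e Sign.* (τ e Sign.* sign b)  ≡⟨ cong (τ e Sign.*_) sign′-a ⟨
      τ e Sign.* sign′ a              ∎
      where open ≡-Reasoning
    balanced′ {f} {u} {v} (there f∈L) k = begin
      scale (component u) Sign.* sign u
        ≡⟨ cong₂ (λ i s → scale i Sign.* s) (joined f∈L k) (balanced f∈L k) ⟩
      t Sign.* (τ f Sign.* sign v)
        ≡⟨ Sign.*-assoc t (τ f) (sign v) ⟨
      (t Sign.* τ f) Sign.* sign v
        ≡⟨ cong (Sign._* sign v) (Sign.*-comm t (τ f)) ⟩
      (τ f Sign.* t) Sign.* sign v
        ≡⟨ Sign.*-assoc (τ f) t (sign v) ⟩
      τ f Sign.* (t Sign.* sign v) ∎
      where
      open ≡-Reasoning
      t = scale (component v)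

    joined′ : ∀ {f u v} → f ∈ e ∷ L → Joins f u v →
              merge (component u) ≡ merge (component v)
    joined′ (here refl) k with joins-unique j k
    ... | inj₁ (refl , refl) = trans merge-a (sym merge-b)
    ... | inj₂ (refl , refl) = trans merge-b (sym merge-a)
    joined′ (there f∈L) k = cong merge (joined f∈L k)

    weaken : ∀ {u v} → Connected L u v → Connected (e ∷ L) u v
    weaken = Star.map λ (f , f∈L , k) → f , there f∈L , k

    connected′ : ∀ {u v} → merge (component u) ≡ merge (component v) →
                 Connected (e ∷ L) u v
    connected′ {u} {v} eq
      -- Deciding both tests also evaluates `merge` in `eq`. In the mixed cases `eq` puts the other
      -- vertex in the component of `b`, and the new edge is the bridge.
      with component u Fin.≟ component a | component v Fin.≟ component a
    ... | yes u~a | yes v~a = weaken (connected (trans u~a (sym v~a)))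
    ... | yes u~a | no _    =
      weaken (connected u~a) ◅◅ (e , here refl , j) ◅ weaken (connected eq)
    ... | no _    | yes v~a =
      weaken (connected eq) ◅◅ (e , here refl , swap j) ◅ weaken (connected (sym v~a))
    ... | no _    | no _    = weaken (connected eq)

    extend : Balancing τ (e ∷ L)
    extend = record
      { sign = sign′ ; component = merge ∘ component
      ; balanced = balanced′ ; joined = joined′ ; connected = connected′ }

  balancing : ∀ τ {L} → Unique L → Acyclic L → Balancing τ L
  balancing τ [] _ = record
    { sign = λ _ → Sign.+ ; component = λ v → v
    ; balanced = λ () ; joined = λ () ; connected = λ { refl → ε } }
  balancing τ (e∉L ∷ unique) acyclic =
    Extend.extend
      (balancing τ unique λ p cycle → acyclic p cycle ∘ All.map there)
      acyclic (All¬⇒¬Any e∉L) (inj₁ refl)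

-- Grouping the colours into pairs.

even⊎odd : ∀ n → ∃ λ k → n ≡ 2 * k ⊎ n ≡ 2 * k + 1
even⊎odd zero = 0 , inj₁ refl
even⊎odd (suc n) with even⊎odd n
... | k , inj₁ eq = k , inj₂ (trans (cong suc eq) (ℕ.+-comm 1 (2 * k)))
... | k , inj₂ eq = suc k , inj₁
  (trans (cong suc (trans eq (ℕ.+-comm (2 * k) 1))) (sym (ℕ.*-suc 2 k)))

⌊2n/2⌋ : ∀ n → ⌊ 2 * n /2⌋ ≡ n
⌊2n/2⌋ n = trans (cong (λ m → ⌊ n + m /2⌋) (ℕ.+-identityʳ n)) (sym (ℕ.n≡⌊n+n/2⌋ n))

⌊1+2n/2⌋ : ∀ n → ⌊ suc (2 * n) /2⌋ ≡ n
⌊1+2n/2⌋ n =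
  trans (cong (λ m → ⌊ suc (n + m) /2⌋) (ℕ.+-identityʳ n)) (sym (ℕ.n≡⌈n+n/2⌉ n))

-- The fibres of `⌊_/2⌋` are the pairs 2m, 2m + 1; removing 2 from all three arguments leads down to
-- m = 0.
⌊/2⌋-atMostTwoToOne : ∀ x y z → ⌊ x /2⌋ ≡ ⌊ y /2⌋ → ⌊ x /2⌋ ≡ ⌊ z /2⌋ → y ≢ z →
                      x ≡ y ⊎ x ≡ z
⌊/2⌋-atMostTwoToOne 0 0 _ _ _ _ = inj₁ refl
⌊/2⌋-atMostTwoToOne 0 1 0 _ _ _ = inj₂ refl
⌊/2⌋-atMostTwoToOne 0 1 1 _ _ y≢z = contradiction refl y≢z
⌊/2⌋-atMostTwoToOne 1 1 _ _ _ _ = inj₁ refl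
⌊/2⌋-atMostTwoToOne 1 0 1 _ _ _ = inj₂ refl
⌊/2⌋-atMostTwoToOne 1 0 0 _ _ y≢z = contradiction refl y≢z
⌊/2⌋-atMostTwoToOne (suc (suc x)) (suc (suc y)) (suc (suc z)) p q y≢z =
  Sum.map (cong (2 +_)) (cong (2 +_))
    (⌊/2⌋-atMostTwoToOne x y z (ℕ.suc-injective p) (ℕ.suc-injective q)
      (y≢z ∘ cong (2 +_)))

-- `signed∈M` admits both signs because signs are chosen later, vertex by vertex. Since 0 is fixed
-- by both signs, only one class may carry it. `pairs` expresses that at most two colours share a
-- magnitude, in the form that places a colour in one of two given classes.
record Pairing (n : ℕ) : Set where
  field
    magnitude   : Fin n → ℕ
    signed∈M    : ∀ s i → M n (s ◃ magnitude i)
    zero-unique : ∀ {i j} → magnitude i ≡ 0 → magnitude j ≡ 0 → i ≡ j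
    pairs       : ∀ {i j k} → magnitude i ≡ magnitude j → magnitude i ≡ magnitude k →
                  j ≢ k → i ≡ j ⊎ i ≡ k

-- For odd n, ⌊ (1 + i) /2⌋ runs through 0, 1, 1, 2, 2, …; for even n,
-- ⌊ (2 + i) /2⌋ runs through 1, 1, 2, 2, ….
pairing : ∀ n → Pairing n
pairing n with even⊎odd n
... | k , inj₁ refl = record
  { magnitude   = λ i → ⌊ 2 + toℕ i /2⌋
  ; signed∈M    = λ s i → k , inj₁ (refl ,
      subst (λ m → 1 ≤ m × m ≤ k) (sym (ℤ.abs-◃ s _)) (s≤s z≤n , bound i))
  ; zero-unique = λ ()
  ; pairs       = λ {i} {j} {l} p q j≢l →
      Sum.map Fin.toℕ-injective Fin.toℕ-injective
        (⌊/2⌋-atMostTwoToOne (toℕ i) (toℕ j) (toℕ l)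
          (ℕ.suc-injective p) (ℕ.suc-injective q) (j≢l ∘ Fin.toℕ-injective))
  }
  where
  bound : ∀ i → ⌊ 2 + toℕ i /2⌋ ≤ k
  -- From `i < 2k` follows `2 + i ≤ 1 + 2k`, and halving drops the extra 1.
  bound i = subst (⌊ 2 + toℕ i /2⌋ ≤_) (⌊1+2n/2⌋ k) (ℕ.⌊n/2⌋-mono (s≤s (Fin.toℕ<n i)))
... | k , inj₂ refl = record
  { magnitude   = λ i → ⌊ 1 + toℕ i /2⌋
  ; signed∈M    = λ s i → k , inj₂ (refl ,
      subst (_≤ k) (sym (ℤ.abs-◃ s _)) (bound i))
  ; zero-unique = λ p q → Fin.toℕ-injective (trans (⌊1+n/2⌋≡0 _ p) (sym (⌊1+n/2⌋≡0 _ q)))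
  ; pairs       = λ {i} {j} {l} p q j≢l →
      Sum.map (Fin.toℕ-injective ∘ ℕ.suc-injective) (Fin.toℕ-injective ∘ ℕ.suc-injective)
        (⌊/2⌋-atMostTwoToOne (1 + toℕ i) (1 + toℕ j) (1 + toℕ l)
          p q (j≢l ∘ Fin.toℕ-injective ∘ ℕ.suc-injective))
  }
  where
  bound : ∀ i → ⌊ 1 + toℕ i /2⌋ ≤ k
  bound i = subst (⌊ 1 + toℕ i /2⌋ ≤_)
    (trans (cong ⌊_/2⌋ (ℕ.+-comm (2 * k) 1)) (⌊1+2n/2⌋ k)) (ℕ.⌊n/2⌋-mono (Fin.toℕ<n i))

  ⌊1+n/2⌋≡0 : ∀ m → ⌊ 1 + m /2⌋ ≡ 0 → m ≡ 0
  ⌊1+n/2⌋≡0 zero _ = refl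

-- From an acyclic colouring to a signed colouring.

∣s·z∣ : ∀ s z → ∣ s · z ∣ ≡ ∣ z ∣
∣s·z∣ s z = trans (ℤ.abs-* (s ◃ 1) z)
  (trans (cong (_* ∣ z ∣) (ℤ.abs-◃ s 1)) (ℕ.*-identityˡ ∣ z ∣))

s·t◃m : ∀ s t m → s · (t ◃ m) ≡ (s Sign.* t) ◃ m
s·t◃m s t m = trans (sym (ℤ.◃-distrib-* s t 1 m)) (cong (s Sign.* t ◃_) (ℕ.*-identityˡ m))

module _ (G : SignedGraph) where
  open SignedGraph G
  open Graph underlying hiding (order; Vertex; Edge; Joins; IsSimple)
  open Forests underlying

  module _ {n} (c : Vertex → Fin n) (acyclicColouring : IsAcyclicColouring c) where
    open Pairing (pairing n)

    level : Vertex → ℕ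
    level = magnitude ∘ c

    -- Only on these edges can `φ u ≡ σ e · φ v` occur, since a sign preserves absolute values.
    -- Taken together they treat all pairs of classes at once.
    IsLevel : Edge → Set
    IsLevel e = level (proj₁ (ends e)) ≡ level (proj₂ (ends e))

    isLevel? : ∀ e → Dec (IsLevel e)
    isLevel? e = level (proj₁ (ends e)) ℕ.≟ level (proj₂ (ends e))

    joins⇒level : ∀ {e u v} → IsLevel e → Joins e u v → level u ≡ level v
    joins⇒level same (inj₁ refl) = same
    joins⇒level same (inj₂ refl) = sym same

    level⇒isLevel : ∀ {e u v} → Joins e u v → level u ≡ level v → IsLevel e
    level⇒isLevel (inj₁ refl) same = same
    level⇒isLevel (inj₂ refl) same = sym same

    levelEdges : List Edge
    levelEdges = filter isLevel? (allFin _)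

    level-constant : ∀ {u v} (p : Walk u v) → All (_∈ levelEdges) (edges p) →
                     All (λ x → level x ≡ level u) (vertices p)
    level-constant nil [] = []
    level-constant (cons e j p) (e∈ ∷ p∈) =
      refl ∷ All.map (λ x~v → trans x~v (sym u~v)) (level-constant p p∈)
      where
      u~v = joins⇒level (proj₂ (∈-filter⁻ isLevel? {xs = allFin _} e∈)) j

    -- A walk along such edges stays in one level. The ends of its first edge have different
    -- colours, and by `pairs` that level contains no others, so a cycle would lie in the union of
    -- two classes.
    levelEdges-acyclic : Acyclic levelEdges
    levelEdges-acyclic nil (() , _) _
    levelEdges-acyclic (cons {u} {v} e j p) cycle inL@(e∈ ∷ _) =
      proj₂ acyclicColouring (c u) (c v) cu≢cv (cons e j p) cycle
        (All.map (λ x~u → pairs x~u (trans x~u u~v) cu≢cv)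
          (level-constant (cons e j p) inL))
      where
      cu≢cv = proj₁ acyclicColouring e u v j
      u~v = joins⇒level (proj₂ (∈-filter⁻ isLevel? {xs = allFin _} e∈)) j

    open Balancing (balancing (opposite ∘ σ)
      (Unique.filter⁺ isLevel? (Unique.allFin⁺ _)) levelEdges-acyclic)

    φ : Vertex → ℤ
    φ v = sign v ◃ level v

    φ-proper : IsProperSignedColouring φ
    φ-proper e u v j eq = impossible (level u) refl
      where
      u~v : level u ≡ level v
      u~v = begin
        level u         ≡⟨ ℤ.abs-◃ (sign u) _ ⟨
        ∣ φ u ∣         ≡⟨ cong ∣_∣ eq ⟩
        ∣ σ e · φ v ∣   ≡⟨ ∣s·z∣ (σ e) (φ v) ⟩
        ∣ φ v ∣         ≡⟨ ℤ.abs-◃ (sign v) _ ⟩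
        level v         ∎
        where open ≡-Reasoning

      signs : sign u ≡ opposite (σ e) Sign.* sign v
      signs = balanced (∈-filter⁺ isLevel? (∈-allFin e) (level⇒isLevel j u~v)) j

      impossible : ∀ m → level u ≢ m
      impossible zero    u≡0 =
        proj₁ acyclicColouring e u v j (zero-unique u≡0 (trans (sym u~v) u≡0))
      -- A nonzero integer determines its sign, so the conflict gives `sign u ≡ σ e * sign v`,
      -- against `signs`.
      impossible (suc m) u≡m = Sign.s≢opposite[s] (σ e)
        (Sign.*-cancelʳ-≡ (sign v) (σ e) (opposite (σ e))
          (trans (sym (ℤ.sign-cong eq′)) signs))
        where
        eq′ : sign u ◃ suc m ≡ (σ e Sign.* sign v) ◃ suc m
        eq′ = begin
          sign u ◃ suc m                 ≡⟨ cong (sign u ◃_) u≡m ⟨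
          φ u                            ≡⟨ eq ⟩
          σ e · φ v                      ≡⟨ s·t◃m (σ e) (sign v) (level v) ⟩
          (σ e Sign.* sign v) ◃ level v  ≡⟨ cong (σ e Sign.* sign v ◃_) (trans (sym u~v) u≡m) ⟩
          (σ e Sign.* sign v) ◃ suc m    ∎
          where open ≡-Reasoning

    φ-isColouring : IsColouring n φ
    φ-isColouring = φ-proper , λ v → signed∈M (sign v) (c v)

  acyclicallyColourable⇒colourable : ∀ {n} → AcyclicallyColourable n → Colourable n
  acyclicallyColourable⇒colourable (c , acyclic) = φ c acyclic , φ-isColouring c acyclic

-- `χ` is a minimum over `n ≥ 1` only. A graph has a vertex, and its colour inhabits `Fin n`.
acyclicallyColourable⇒positive : ∀ H {n} → Graph.AcyclicallyColourable H n → 1 ≤ n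
acyclicallyColourable⇒positive H (c , _) =
  ℕ.≤-<-trans z≤n (Fin.toℕ<n (c (fromℕ< (>-nonZero⁻¹ order))))
  where open Graph H

proposition2p5 : (G : SignedGraph) (simple : SignedGraph.IsSimple G) →
    χ G simple ≤ χₐ (SignedGraph.underlying G) simple
-- Minimality of `χ` is applied at the value `χₐ`, with a signed colouring obtained from an optimal
-- acyclic one.
proposition2p5 G simple = proj₂ (χ-isChromaticNumber G simple) _
  ( acyclicallyColourable⇒positive (SignedGraph.underlying G) acyclic
  , acyclicallyColourable⇒colourable G acyclic )
  where
  acyclic = proj₁ (χₐ-isAcyclicChromaticNumber (SignedGraph.underlying G) simple)
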